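{- Let $U$ be a consistent c.e. theory that is effectively ef-essentially incomplete. Then there is a c.e. set $\mathcal X$ of sentences such that $U$ is effectively ef-essentially $\mathcal X$-incomplete and every $\phi\in\mathcal X$ is consistent with $U$.
   Context: Sentences are identified with Gödel numbers. For a set $\mathcal X$ of sentences, $U$ is effectively ef-essentially $\mathcal X$-incomplete iff there is a computable function $\Phi$ on sentences such that for every sentence $\phi$ of the language of $U$ with $U\cup\{\phi\}$ consistent, $\Phi(\phi)$ is independent of $U\cup\{\phi\}$ and $\Phi(\phi)\in\mathcal X$. "Effectively ef-essentially incomplete" is the case where $\mathcal X$ is the set of all sentences. -}

module Defs where

open import Data.Nat using (ℕ; zero; suc; pred; _<ᵇ_; _≡ᵇ_)
open import Data.Bool using (Bool; true; false; T; if_then_else_; _∧_)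
open import Data.Vec using (Vec; []; _∷_)
open import Data.Maybe using (Maybe; just)
open import Data.Product using (Σ; _×_; ∃; proj₁)
open import Data.Sum using (_⊎_)
open import Data.Unit using (⊤)
open import Relation.Nullary using (¬_)
open import Relation.Binary.PropositionalEquality using (_≡_)

-- A computable (Gödel-numbered) first-order language:
-- function / relation symbols are the natural numbers satisfying a
-- decidable predicate, with computable arities.

record Signature : Set where
  field
    isFun    : ℕ → Bool
    funArity : ℕ → ℕ
    isRel    : ℕ → Bool
    relArity : ℕ → ℕ

module FOL (L : Signature) where
  open Signature L

  -- terms and formulas, variables as de Bruijn indices
  data Term : Set where
    var : ℕ → Term
    app : (f : ℕ) → T (isFun f) → Vec Term (funArity f) → Term

  infixr 6 _⇒_
  infix 7 _≐_
  data Formula : Set where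
    ⊥'  : Formula
    rel : (r : ℕ) → T (isRel r) → Vec Term (relArity r) → Formula
    _≐_ : Term → Term → Formula
    _⇒_ : Formula → Formula → Formula
    ∀'  : Formula → Formula

  ¬' : Formula → Formula
  ¬' φ = φ ⇒ ⊥'

  mutual
    shiftT : ℕ → Term → Term
    shiftT c (var n) = if n <ᵇ c then var n else var (suc n)
    shiftT c (app f p ts) = app f p (shiftTs c ts)

    shiftTs : ∀ {k} → ℕ → Vec Term k → Vec Term k
    shiftTs c [] = []
    shiftTs c (t ∷ ts) = shiftT c t ∷ shiftTs c ts

  shiftF : ℕ → Formula → Formula
  shiftF c ⊥' = ⊥'
  shiftF c (rel r p ts) = rel r p (shiftTs c ts)
  shiftF c (s ≐ t) = shiftT c s ≐ shiftT c t
  shiftF c (φ ⇒ ψ) = shiftF c φ ⇒ shiftF c ψ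
  shiftF c (∀' φ) = ∀' (shiftF (suc c) φ)

  substVar : ℕ → Term → ℕ → Term
  substVar k s n = if n <ᵇ k then var n else (if n ≡ᵇ k then s else var (pred n))

  mutual
    substT : ℕ → Term → Term → Term
    substT k s (var n) = substVar k s n
    substT k s (app f p ts) = app f p (substTs k s ts)

    substTs : ∀ {m} → ℕ → Term → Vec Term m → Vec Term m
    substTs k s [] = []
    substTs k s (t ∷ ts) = substT k s t ∷ substTs k s ts

  substF : ℕ → Term → Formula → Formula
  substF k s ⊥' = ⊥'
  substF k s (rel r p ts) = rel r p (substTs k s ts)
  substF k s (a ≐ b) = substT k s a ≐ substT k s b
  substF k s (φ ⇒ ψ) = substF k s φ ⇒ substF k s ψ
  substF k s (∀' φ) = ∀' (substF (suc k) (shiftT 0 s) φ)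

  _[_] : Formula → Term → Formula
  φ [ t ] = substF 0 t φ

  mutual
    closedT : ℕ → Term → Bool
    closedT c (var n) = n <ᵇ c
    closedT c (app f p ts) = closedTs c ts

    closedTs : ∀ {k} → ℕ → Vec Term k → Bool
    closedTs c [] = true
    closedTs c (t ∷ ts) = closedT c t ∧ closedTs c ts

  closedF : ℕ → Formula → Bool
  closedF c ⊥' = true
  closedF c (rel r p ts) = closedTs c ts
  closedF c (s ≐ t) = closedT c s ∧ closedT c t
  closedF c (φ ⇒ ψ) = closedF c φ ∧ closedF c ψ
  closedF c (∀' φ) = closedF (suc c) φ

  Sentence : Set
  Sentence = Σ Formula (λ φ → T (closedF 0 φ))

  -- Classical natural deduction with equality; contexts are (possibly
  -- infinite) sets of formulas, derivations are finite trees.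

  Ctx : Set₁
  Ctx = Formula → Set

  _,,_ : Ctx → Formula → Ctx
  (Γ ,, φ) ψ = Γ ψ ⊎ ψ ≡ φ

  ↑ : Ctx → Ctx
  ↑ Γ ψ = Σ Formula (λ χ → Γ χ × ψ ≡ shiftF 0 χ)

  infix 4 _⊢_
  data _⊢_ : Ctx → Formula → Set₁ where
    ax     : ∀ {Γ φ} → Γ φ → Γ ⊢ φ
    ⇒I     : ∀ {Γ φ ψ} → (Γ ,, φ) ⊢ ψ → Γ ⊢ φ ⇒ ψ
    ⇒E     : ∀ {Γ φ ψ} → Γ ⊢ φ ⇒ ψ → Γ ⊢ φ → Γ ⊢ ψ
    raa    : ∀ {Γ φ} → (Γ ,, ¬' φ) ⊢ ⊥' → Γ ⊢ φ
    ∀I     : ∀ {Γ φ} → ↑ Γ ⊢ φ → Γ ⊢ ∀' φ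
    ∀E     : ∀ {Γ φ} → Γ ⊢ ∀' φ → (t : Term) → Γ ⊢ φ [ t ]
    ≐refl  : ∀ {Γ} (t : Term) → Γ ⊢ t ≐ t
    ≐subst : ∀ {Γ φ s t} → Γ ⊢ s ≐ t → Γ ⊢ φ [ s ] → Γ ⊢ φ [ t ]

  Theory : Set₁
  Theory = Sentence → Set

  ⌜_⌝ : Theory → Ctx
  ⌜ U ⌝ ψ = Σ Sentence (λ s → U s × proj₁ s ≡ ψ)

  _⊩_ : Theory → Sentence → Set₁
  U ⊩ φ = ⌜ U ⌝ ⊢ proj₁ φ

  Consistent : Theory → Set₁
  Consistent U = ¬ (⌜ U ⌝ ⊢ ⊥')

  _∪｛_｝ : Theory → Sentence → Theory
  (U ∪｛ φ ｝) ψ = U ψ ⊎ ψ ≡ φ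

  Independent : Theory → Sentence → Set₁
  Independent U φ = ¬ (U ⊩ φ) × ¬ (⌜ U ⌝ ⊢ ¬' (proj₁ φ))

  -- c.e. set of sentences: range of a computable enumeration
  -- (computable = definable Agda function; `nothing` = skip)
  IsCE : (Sentence → Set) → Set
  IsCE X = Σ (ℕ → Maybe Sentence) (λ e →
             (s : Sentence) → (X s → ∃ (λ n → e n ≡ just s))
                            × (∃ (λ n → e n ≡ just s) → X s))

  EffEssIncompleteIn : Theory → (Sentence → Set) → Set₁
  EffEssIncompleteIn U X =
    Σ (Sentence → Sentence) (λ Φ → (φ : Sentence) → Consistent (U ∪｛ φ ｝) →
        Independent (U ∪｛ φ ｝) (Φ φ) × X (Φ φ))

  EffEssIncomplete : Theory → Set₁
  EffEssIncomplete U = EffEssIncompleteIn U (λ _ → ⊤)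

{-# OPTIONS --safe #-}
-- Replace the selector Φ by φ ↦ (φ ⇒ Φ φ) and let 𝒳 be its range.  Over U ∪ {φ} the
-- sentence φ ⇒ Φ φ is equivalent to Φ φ, so it is still independent.  If U refuted
-- φ ⇒ Φ φ, then U would prove φ (so U ∪ {φ} is consistent) and ¬ Φ φ, contradicting
-- the independence of Φ φ from U ∪ {φ}.  𝒳 is c.e. because it is the image of a
-- computable enumeration of all sentences.
module Submission where

open import Defs
open import Data.Bool using (T)
open import Data.Bool.Properties using (T?; T-irrelevant; T-∧)
open import Data.Maybe using (Maybe; just)
import Data.Maybe as Maybe
open import Data.Maybe.Properties using (map-just; just-injective)
open import Data.Nat using (ℕ; zero; suc; _+_; _≤_; _⊔_; s≤s)
open import Data.Nat.Properties using (+-suc; +-identityʳ; suc-injective; ≤-refl; m⊔n≤o⇒m≤o; m⊔n≤o⇒n≤o)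
open import Data.Product using (Σ; _×_; _,_; proj₁; proj₂; ∃; uncurry)
open import Data.Sum using (inj₁; inj₂)
open import Data.Vec using (Vec; []; _∷_)
open import Data.Vec.Relation.Unary.All using (All; []; _∷_)
open import Function using (_∘_)
open import Function.Bundles using (Equivalence)
open import Relation.Nullary using (¬_; Dec; yes; no)
open import Relation.Nullary.Decidable using (dec⇒maybe; dec-yes-irr)
open import Relation.Unary using (_⊆′_)
open import Relation.Binary.PropositionalEquality using (_≡_; refl; sym; trans; cong; cong₂)

next : ℕ × ℕ → ℕ × ℕ
next (zero  , b) = suc b , zero
next (suc a , b) = a , suc b

unpair : ℕ → ℕ × ℕ
unpair zero    = zero , zero
unpair (suc n) = next (unpair n)

unpair-surjective : ∀ p → ∃ λ n → unpair n ≡ p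
unpair-surjective (a , b) = onDiagonal (a + b) a b refl
  where
  onDiagonal : ∀ s a b → a + b ≡ s → ∃ λ n → unpair n ≡ (a , b)
  onDiagonal s a (suc b) eq
    with n , p ← onDiagonal s (suc a) b (trans (sym (+-suc a b)) eq) = suc n , cong next p
  onDiagonal s       zero    zero _  = zero , refl
  onDiagonal (suc s) (suc a) zero eq
    with n , p ← onDiagonal s zero a (trans (sym (+-identityʳ a)) (suc-injective eq)) = suc n , cong next p

pair : ℕ → ℕ → ℕ
pair a b = proj₁ (unpair-surjective (a , b))

unpair-pair : ∀ a b → unpair (pair a b) ≡ (a , b)
unpair-pair a b = proj₂ (unpair-surjective (a , b))

record Eventually (P : ℕ → Set) : Set where
  constructor from_on_
  field
    start : ℕ
    holds : ∀ {k} → start ≤ k → P k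

module _ {P : ℕ → Set} where

  always : (∀ k → P k) → Eventually P
  always p = from zero on λ {k} _ → p k

  eventually-suc : Eventually (P ∘ suc) → Eventually P
  eventually-suc (from k₀ on p) = from suc k₀ on λ { (s≤s le) → p le }

module _ {P Q : ℕ → Set} where

  eventually-map : (∀ {k} → P k → Q k) → Eventually P → Eventually Q
  eventually-map f (from k₀ on p) = from k₀ on (f ∘ p)

  eventually-× : Eventually P → Eventually Q → Eventually (λ k → P k × Q k)
  eventually-× (from k₀ on p) (from k₁ on q) =
    from k₀ ⊔ k₁ on λ le → p (m⊔n≤o⇒m≤o k₀ k₁ le) , q (m⊔n≤o⇒n≤o k₀ k₁ le)

-- Decoders take a fuel argument k first, which bounds the depth of what they can produce.
HasCode : {A : Set} → (ℕ → ℕ → A) → A → Set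
HasCode decode x = ∃ λ n → Eventually (λ k → decode k n ≡ x)

decodeVec : {A : Set} → (ℕ → A) → (m : ℕ) → ℕ → Vec A m
decodeVec decode zero    _ = []
decodeVec decode (suc m) n = let a , b = unpair n in decode a ∷ decodeVec decode m b

hasCode-vec : {A : Set} {decode : ℕ → ℕ → A} {m : ℕ} {xs : Vec A m} →
              All (HasCode decode) xs → HasCode (λ k → decodeVec (decode k) m) xs
hasCode-vec [] = zero , always (λ _ → refl)
hasCode-vec {decode = decode} {suc m} {x ∷ xs} ((a , ea) ∷ hs) with b , eb ← hasCode-vec hs =
  pair a b , eventually-map step (eventually-× ea eb)
  where
  step : ∀ {k} → decode k a ≡ x × decodeVec (decode k) m b ≡ xs →
         decodeVec (decode k) (suc m) (pair a b) ≡ x ∷ xs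
  step (p , q) rewrite unpair-pair a b = cong₂ _∷_ p q

module Enumeration (L : Signature) where
  open Signature L
  open FOL L

  appIfFun : (f : ℕ) → Dec (T (isFun f)) → Vec Term (funArity f) → Term
  appIfFun f (yes p) ts = app f p ts
  appIfFun f (no _)  _  = var 0

  relIfRel : (r : ℕ) → Dec (T (isRel r)) → Vec Term (relArity r) → Formula
  relIfRel r (yes p) ts = rel r p ts
  relIfRel r (no _)  _  = ⊥'

  mutual
    decodeTerm : ℕ → ℕ → Term
    decodeTerm zero    _ = var 0
    decodeTerm (suc k) n = decodeTermCase k (unpair n)

    decodeTermCase : ℕ → ℕ × ℕ → Term
    decodeTermCase k (zero  , v) = var v
    decodeTermCase k (suc _ , c) =
      let f , c′ = unpair c in appIfFun f (T? (isFun f)) (decodeVec (decodeTerm k) (funArity f) c′)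

  mutual
    decodeFormula : ℕ → ℕ → Formula
    decodeFormula zero    _ = ⊥'
    decodeFormula (suc k) n = decodeFormulaCase k (unpair n)

    decodeFormulaCase : ℕ → ℕ × ℕ → Formula
    decodeFormulaCase k (0 , _) = ⊥'
    decodeFormulaCase k (1 , c) =
      let r , c′ = unpair c in relIfRel r (T? (isRel r)) (decodeVec (decodeTerm k) (relArity r) c′)
    decodeFormulaCase k (2 , c) = let a , b = unpair c in decodeTerm k a ≐ decodeTerm k b
    decodeFormulaCase k (3 , c) = let a , b = unpair c in decodeFormula k a ⇒ decodeFormula k b
    decodeFormulaCase k (suc (suc (suc (suc _))) , c) = ∀' (decodeFormula k c)

  mutual
    hasCode-term : (t : Term) → HasCode decodeTerm t
    hasCode-term (var v) = pair 0 v , eventually-suc (always step)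
      where
      step : ∀ k → decodeTerm (suc k) (pair 0 v) ≡ var v
      step k rewrite unpair-pair 0 v = refl
    hasCode-term (app f p ts) with c , ec ← hasCode-vec (hasCode-terms ts) =
      pair 1 (pair f c) , eventually-suc (eventually-map step ec)
      where
      step : ∀ {k} → decodeVec (decodeTerm k) (funArity f) c ≡ ts →
             decodeTerm (suc k) (pair 1 (pair f c)) ≡ app f p ts
      step eq rewrite unpair-pair 1 (pair f c) | unpair-pair f c
                    | dec-yes-irr (T? (isFun f)) T-irrelevant p = cong (app f p) eq

    hasCode-terms : ∀ {m} (ts : Vec Term m) → All (HasCode decodeTerm) ts
    hasCode-terms []       = []
    hasCode-terms (t ∷ ts) = hasCode-term t ∷ hasCode-terms ts

  hasCode-formula : (φ : Formula) → HasCode decodeFormula φ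
  hasCode-formula ⊥' = pair 0 0 , eventually-suc (always step)
    where
    step : ∀ k → decodeFormula (suc k) (pair 0 0) ≡ ⊥'
    step k rewrite unpair-pair 0 0 = refl
  hasCode-formula (rel r p ts) with c , ec ← hasCode-vec (hasCode-terms ts) =
    pair 1 (pair r c) , eventually-suc (eventually-map step ec)
    where
    step : ∀ {k} → decodeVec (decodeTerm k) (relArity r) c ≡ ts →
           decodeFormula (suc k) (pair 1 (pair r c)) ≡ rel r p ts
    step eq rewrite unpair-pair 1 (pair r c) | unpair-pair r c
                  | dec-yes-irr (T? (isRel r)) T-irrelevant p = cong (rel r p) eq
  hasCode-formula (s ≐ t)
    with a , ea ← hasCode-term s | b , eb ← hasCode-term t =
    pair 2 (pair a b) , eventually-suc (eventually-map step (eventually-× ea eb))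
    where
    step : ∀ {k} → decodeTerm k a ≡ s × decodeTerm k b ≡ t →
           decodeFormula (suc k) (pair 2 (pair a b)) ≡ (s ≐ t)
    step (p , q) rewrite unpair-pair 2 (pair a b) | unpair-pair a b = cong₂ _≐_ p q
  hasCode-formula (φ ⇒ ψ)
    with a , ea ← hasCode-formula φ | b , eb ← hasCode-formula ψ =
    pair 3 (pair a b) , eventually-suc (eventually-map step (eventually-× ea eb))
    where
    step : ∀ {k} → decodeFormula k a ≡ φ × decodeFormula k b ≡ ψ →
           decodeFormula (suc k) (pair 3 (pair a b)) ≡ (φ ⇒ ψ)
    step (p , q) rewrite unpair-pair 3 (pair a b) | unpair-pair a b = cong₂ _⇒_ p q
  hasCode-formula (∀' φ) with a , ea ← hasCode-formula φ =
    pair 4 a , eventually-suc (eventually-map step ea)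
    where
    step : ∀ {k} → decodeFormula k a ≡ φ → decodeFormula (suc k) (pair 4 a) ≡ ∀' φ
    step eq rewrite unpair-pair 4 a = cong ∀' eq

  formulaAt : ℕ → Formula
  formulaAt = uncurry decodeFormula ∘ unpair

  formulaAt-surjective : ∀ φ → ∃ λ n → formulaAt n ≡ φ
  formulaAt-surjective φ with n , from k₀ on h ← hasCode-formula φ =
    pair k₀ n , trans (cong (uncurry decodeFormula) (unpair-pair k₀ n)) (h ≤-refl)

  toSentence : Formula → Maybe Sentence
  toSentence φ = Maybe.map (φ ,_) (dec⇒maybe (T? (closedF 0 φ)))

  toSentence-proj₁ : (s : Sentence) → toSentence (proj₁ s) ≡ just s
  toSentence-proj₁ (φ , closed) rewrite dec-yes-irr (T? (closedF 0 φ)) T-irrelevant closed = refl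

  sentenceAt : ℕ → Maybe Sentence
  sentenceAt = toSentence ∘ formulaAt

  sentenceAt-complete : ∀ s → ∃ λ n → sentenceAt n ≡ just s
  sentenceAt-complete s with n , eq ← formulaAt-surjective (proj₁ s) =
    n , trans (cong toSentence eq) (toSentence-proj₁ s)

  range-isCE : {A : Set} (e : ℕ → Maybe A) → (∀ a → ∃ λ n → e n ≡ just a) →
               (f : A → Sentence) → IsCE (λ s → ∃ λ a → f a ≡ s)
  range-isCE e e-complete f = Maybe.map f ∘ e , λ s → enumerated s , inRange s
    where
    enumerated : ∀ s → ∃ (λ a → f a ≡ s) → ∃ λ n → Maybe.map f (e n) ≡ just s
    enumerated _ (a , refl) with n , eq ← e-complete a = n , map-just eq

    inRange : ∀ s → ∃ (λ n → Maybe.map f (e n) ≡ just s) → ∃ λ a → f a ≡ s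
    inRange s (n , eq) with e n
    ... | just a = a , just-injective eq

module Logic (L : Signature) where
  open FOL L

  ,,-mono : ∀ {Γ Δ φ} → Γ ⊆′ Δ → (Γ ,, φ) ⊆′ (Δ ,, φ)
  ,,-mono Γ⊆Δ _ (inj₁ γ) = inj₁ (Γ⊆Δ _ γ)
  ,,-mono Γ⊆Δ _ (inj₂ e) = inj₂ e

  ↑-mono : ∀ {Γ Δ} → Γ ⊆′ Δ → ↑ Γ ⊆′ ↑ Δ
  ↑-mono Γ⊆Δ _ (χ , γ , e) = χ , Γ⊆Δ χ γ , e

  weaken : ∀ {Γ Δ φ} → Γ ⊆′ Δ → Γ ⊢ φ → Δ ⊢ φ
  weaken Γ⊆Δ (ax γ)        = ax (Γ⊆Δ _ γ)
  weaken Γ⊆Δ (⇒I d)        = ⇒I (weaken (,,-mono Γ⊆Δ) d)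
  weaken Γ⊆Δ (⇒E d e)      = ⇒E (weaken Γ⊆Δ d) (weaken Γ⊆Δ e)
  weaken Γ⊆Δ (raa d)       = raa (weaken (,,-mono Γ⊆Δ) d)
  weaken Γ⊆Δ (∀I d)        = ∀I (weaken (↑-mono Γ⊆Δ) d)
  weaken Γ⊆Δ (∀E d t)      = ∀E (weaken Γ⊆Δ d) t
  weaken Γ⊆Δ (≐refl t)     = ≐refl t
  weaken Γ⊆Δ (≐subst d e)  = ≐subst (weaken Γ⊆Δ d) (weaken Γ⊆Δ e)

  weaken₁ : ∀ {Γ φ ψ} → Γ ⊢ φ → (Γ ,, ψ) ⊢ φ
  weaken₁ = weaken (λ _ → inj₁)

  ¬⇒-antecedent : ∀ {Γ φ ψ} → Γ ⊢ ¬' (φ ⇒ ψ) → Γ ⊢ φ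
  ¬⇒-antecedent d =
    raa (⇒E (weaken₁ d) (⇒I (raa (⇒E (ax (inj₁ (inj₁ (inj₂ refl)))) (ax (inj₁ (inj₂ refl)))))))

  ¬⇒-¬consequent : ∀ {Γ φ ψ} → Γ ⊢ ¬' (φ ⇒ ψ) → Γ ⊢ ¬' ψ
  ¬⇒-¬consequent d = ⇒I (⇒E (weaken₁ d) (⇒I (ax (inj₁ (inj₂ refl)))))

  ∪-⊇ : ∀ {U φ} → ⌜ U ⌝ ⊆′ ⌜ U ∪｛ φ ｝ ⌝
  ∪-⊇ _ (s , u , e) = s , inj₁ u , e

  ∪-⊆ : ∀ {U φ} → ⌜ U ∪｛ φ ｝ ⌝ ⊆′ (⌜ U ⌝ ,, proj₁ φ)
  ∪-⊆ _ (s , inj₁ u    , e) = inj₁ (s , u , e)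
  ∪-⊆ _ (s , inj₂ refl , e) = inj₂ (sym e)

  assumption : ∀ {U φ} → (U ∪｛ φ ｝) ⊩ φ
  assumption = ax (_ , inj₂ refl , refl)

  deduction : ∀ {U φ ψ} → ⌜ U ∪｛ φ ｝ ⌝ ⊢ ψ → ⌜ U ⌝ ⊢ proj₁ φ ⇒ ψ
  deduction d = ⇒I (weaken ∪-⊆ d)

  consistent-∪-provable : ∀ {U φ} → Consistent U → U ⊩ φ → Consistent (U ∪｛ φ ｝)
  consistent-∪-provable con ⊢φ ⊢⊥ = con (⇒E (deduction ⊢⊥) ⊢φ)

  infixr 6 _⇛_
  _⇛_ : Sentence → Sentence → Sentence
  (φ , φ-closed) ⇛ (ψ , ψ-closed) = φ ⇒ ψ , Equivalence.from T-∧ (φ-closed , ψ-closed)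

  ⇛-independent : ∀ {U φ ψ} → Independent (U ∪｛ φ ｝) ψ → Independent (U ∪｛ φ ｝) (φ ⇛ ψ)
  ⇛-independent (⊬ψ , ⊬¬ψ) = (λ d → ⊬ψ (⇒E d assumption)) , (λ d → ⊬¬ψ (¬⇒-¬consequent d))

  ⇛-consistent : ∀ {U φ ψ} → Consistent U →
                 (Consistent (U ∪｛ φ ｝) → ¬ (⌜ U ∪｛ φ ｝ ⌝ ⊢ ¬' (proj₁ ψ))) →
                 Consistent (U ∪｛ φ ⇛ ψ ｝)
  ⇛-consistent {U} {φ} {ψ} con ⊬¬ψ ⊢⊥ =
    ⊬¬ψ (consistent-∪-provable con (¬⇒-antecedent ⊢¬φ⇛ψ)) (weaken ∪-⊇ (¬⇒-¬consequent ⊢¬φ⇛ψ))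
    where
    ⊢¬φ⇛ψ : ⌜ U ⌝ ⊢ ¬' (proj₁ (φ ⇛ ψ))
    ⊢¬φ⇛ψ = deduction ⊢⊥

theorem4p5 : (L : Signature) → let open FOL L in
    (U : Theory) → IsCE U → Consistent U → EffEssIncomplete U →
    Σ (Sentence → Set) (λ X → IsCE X × EffEssIncompleteIn U X
    × ((φ : Sentence) → X φ → Consistent (U ∪｛ φ ｝)))
theorem4p5 L U _ con (Φ , Φ-independent) =
  X , range-isCE sentenceAt sentenceAt-complete Φ′ , (Φ′ , Φ′-independent) , X-consistent
  where
  open FOL L
  open Enumeration L
  open Logic L

  Φ′ : Sentence → Sentence
  Φ′ φ = φ ⇛ Φ φ

  X : Sentence → Set
  X ψ = ∃ λ φ → Φ′ φ ≡ ψ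

  Φ′-independent : ∀ φ → Consistent (U ∪｛ φ ｝) → Independent (U ∪｛ φ ｝) (Φ′ φ) × X (Φ′ φ)
  Φ′-independent φ con-φ = ⇛-independent {U} {φ} {Φ φ} (proj₁ (Φ-independent φ con-φ)) , φ , refl

  X-consistent : ∀ ψ → X ψ → Consistent (U ∪｛ ψ ｝)
  X-consistent _ (φ , refl) = ⇛-consistent con (λ con-φ → proj₂ (proj₁ (Φ-independent φ con-φ)))
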